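{- A category $C$ is Möbius if and only if the following three conditions hold: (1) $\mathrm{PD}_2f$ is finite for every morphism $f$; (2) no identity morphism admits a proper decomposition of length $n\ge2$; (3) if a morphism $f$ fixes some morphism $g$ (i.e. $fg=g$ or $gf=g$), then $f$ is an identity morphism.
   Context: For a morphism $f$ and $n\ge1$, an $n$-decomposition of $f$ is a tuple $(f_1,\dots,f_n)$ of composable morphisms with $f_n\cdots f_1=f$; $\mathrm{D}_nf$ is the set of them. For $n\ge2$, $\mathrm{PD}_nf$ is the set of proper $n$-decompositions (none of the $f_i$ is an identity); $\mathrm{PD}_1f=\{f\}$ and $\mathrm{PD}f=\bigsqcup_{n\ge1}\mathrm{PD}_nf$. A category is Möbius if $\mathrm{PD}f$ is finite for every morphism $f$. -}

module Defs where

open import Data.Fin.Base using (Fin)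
open import Data.Nat.Base using (ℕ; suc)
open import Data.Product.Base using (Σ; ∃; _×_; proj₁; ∃-syntax; Σ-syntax)
open import Data.Product.Relation.Binary.Pointwise.Dependent using () renaming (setoid to Σ-setoid)
open import Data.Sum.Base using (_⊎_)
open import Data.Unit.Polymorphic.Base using (⊤)
open import Function.Bundles using (Inverse)
open import Level using (Level; _⊔_) renaming (suc to lsuc)
open import Relation.Binary.Bundles using (Setoid)
open import Relation.Binary.Core using (Rel)
open import Relation.Binary.Indexed.Heterogeneous using (IndexedSetoid)
open import Relation.Binary.PropositionalEquality.Properties using () renaming (setoid to ≡-setoid)
open import Relation.Binary.Structures using (IsEquivalence)
open import Relation.Nullary.Negation.Core using (¬_)

private
  variable
    a r : Level

Finite : Setoid a r → Set (a ⊔ r)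
Finite S = ∃[ n ] Inverse S (≡-setoid (Fin n))

-- Morphisms are compared by _≈_, objects by propositional equality.

record Category (o ℓ e : Level) : Set (lsuc (o ⊔ ℓ ⊔ e)) where
  infix  4 _≈_
  infixr 9 _∘_
  field
    Obj       : Set o
    Hom       : Obj → Obj → Set ℓ
    _≈_       : ∀ {A B} → Rel (Hom A B) e
    id        : ∀ {A} → Hom A A
    _∘_       : ∀ {A B C} → Hom B C → Hom A B → Hom A C
    ≈-equiv   : ∀ {A B} → IsEquivalence (_≈_ {A} {B})
    ∘-cong    : ∀ {A B C} {f f′ : Hom B C} {g g′ : Hom A B} →
                f ≈ f′ → g ≈ g′ → f ∘ g ≈ f′ ∘ g′
    assoc     : ∀ {A B C D} (f : Hom C D) (g : Hom B C) (h : Hom A B) →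
                (f ∘ g) ∘ h ≈ f ∘ (g ∘ h)
    identityˡ : ∀ {A B} (f : Hom A B) → id ∘ f ≈ f
    identityʳ : ∀ {A B} (f : Hom A B) → f ∘ id ≈ f

module Decompositions {o ℓ e} (C : Category o ℓ e) where
  open Category C
  private
    module Eq {A B} = IsEquivalence (≈-equiv {A} {B})

  -- Source and target are not assumed equal: being an identity forces it.

  data IsIdentity {A : Obj} : {B : Obj} → Hom A B → Set (ℓ ⊔ e) where
    is-id : {f : Hom A A} → f ≈ id → IsIdentity f

  -- An equation f ∘ g ≈ g or g ∘ f ≈ g can only hold when f is an
  -- endomorphism.

  FixesSome : ∀ {B} → Hom B B → Set (o ⊔ ℓ ⊔ e)
  FixesSome {B} f = (∃[ A ] Σ[ g ∈ Hom A B ] f ∘ g ≈ g)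
                  ⊎ (∃[ D ] Σ[ g ∈ Hom B D ] g ∘ f ≈ g)

  -- Chain B n A is the set of composable tuples (f₁ , … , fₙ) leading from
  -- A to B, with f₁ at the head; it is empty for n = 0.

  infixr 5 _∷_
  data Chain (B : Obj) : ℕ → Obj → Set (o ⊔ ℓ) where
    [_] : ∀ {A} → Hom A B → Chain B 1 A
    _∷_ : ∀ {n A M} → Hom A M → Chain B n M → Chain B (suc n) A

  compose : ∀ {n A B} → Chain B n A → Hom A B
  compose [ f ]    = f
  compose (f ∷ fs) = compose fs ∘ f

  NoIdentity : ∀ {n A B} → Chain B n A → Set (ℓ ⊔ e)
  NoIdentity [ f ]    = ¬ IsIdentity f
  NoIdentity (f ∷ fs) = ¬ IsIdentity f × NoIdentity fs

  -- A 1-tuple is always proper, since PD₁ f = {f} even when f is an identity.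

  Proper : ∀ {n A B} → Chain B n A → Set (ℓ ⊔ e)
  Proper [ _ ]    = ⊤
  Proper (f ∷ fs) = NoIdentity (f ∷ fs)

  -- Equality of tuples: same length, same intermediate objects, equal entries.

  infix 4 _≋_
  data _≋_ {B : Obj} : ∀ {m n A} → Chain B m A → Chain B n A → Set (o ⊔ ℓ ⊔ e) where
    [_] : ∀ {A} {f g : Hom A B} → f ≈ g → [ f ] ≋ [ g ]
    _∷_ : ∀ {m n A M} {f g : Hom A M} {fs : Chain B m M} {gs : Chain B n M} →
          f ≈ g → fs ≋ gs → f ∷ fs ≋ g ∷ gs

  ≋-refl : ∀ {n A B} {c : Chain B n A} → c ≋ c
  ≋-refl {c = [ _ ]}  = [ Eq.refl ]
  ≋-refl {c = _ ∷ _} = Eq.refl ∷ ≋-refl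

  ≋-sym : ∀ {m n A B} {c : Chain B m A} {d : Chain B n A} → c ≋ d → d ≋ c
  ≋-sym [ p ]    = [ Eq.sym p ]
  ≋-sym (p ∷ ps) = Eq.sym p ∷ ≋-sym ps

  ≋-trans : ∀ {k m n A B} {b : Chain B k A} {c : Chain B m A} {d : Chain B n A} →
            b ≋ c → c ≋ d → b ≋ d
  ≋-trans [ p ]    [ q ]    = [ Eq.trans p q ]
  ≋-trans (p ∷ ps) (q ∷ qs) = Eq.trans p q ∷ ≋-trans ps qs

  D : ∀ {A B} → ℕ → Hom A B → Set (o ⊔ ℓ ⊔ e)
  D {A} {B} n f = Σ[ c ∈ Chain B n A ] compose c ≈ f

  PD : ∀ {A B} → ℕ → Hom A B → Set (o ⊔ ℓ ⊔ e)
  PD n f = Σ[ d ∈ D n f ] Proper (proj₁ d)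

  -- Proper decompositions are compared as tuples, ignoring the proofs.

  PD-indexedSetoid : ∀ {A B} → Hom A B → IndexedSetoid ℕ (o ⊔ ℓ ⊔ e) (o ⊔ ℓ ⊔ e)
  PD-indexedSetoid f = record
    { Carrier       = λ n → PD n f
    ; _≈_           = λ x y → proj₁ (proj₁ x) ≋ proj₁ (proj₁ y)
    ; isEquivalence = record { refl = ≋-refl ; sym = ≋-sym ; trans = ≋-trans }
    }

  -- The disjoint union over all lengths; length 0 contributes nothing.

  PD-setoid : ∀ {A B} → Hom A B → Setoid (o ⊔ ℓ ⊔ e) (o ⊔ ℓ ⊔ e)
  PD-setoid f = Σ-setoid (≡-setoid ℕ) (PD-indexedSetoid f)

  Möbius : Set (o ⊔ ℓ ⊔ e)
  Möbius = ∀ {A B} (f : Hom A B) → Finite (PD-setoid f)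

{-# OPTIONS --safe #-}

-- A chain of non-identities whose composite fixes a non-identity g can be
-- attached to g repeatedly, giving arbitrarily long proper decompositions of g;
-- a proper decomposition of an identity fixes its own first entry in this way.
-- So finiteness of PD forbids both. Conversely, cutting a proper chain of length
-- n + 1 at its n joints gives n elements of PD₂ f, and these are distinct: the
-- morphism between two joints giving equal cuts would fix the part before
-- them, hence be an identity, although it is a composite of non-identities.
-- So the lengths are bounded by |PD₂ f| + 1, and splitting off the first
-- morphism leaves finitely many chains below any given length.

module Submission where

open import Defs
open import Axiom.ExcludedMiddle using (ExcludedMiddle)
open import Data.Empty using (⊥)
open import Data.Fin.Base using (Fin; zero; suc) renaming (_<_ to _<ᶠ_)
open import Data.Fin.Properties using (<-cmp; injective⇒≤)
open import Data.List.Base using (List; []; _∷_; lookup; concatMap; map; tabulate; allFin)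
open import Data.List.Extrema.Nat using (max; xs≤max)
open import Data.List.Membership.Propositional.Properties using (∈-allFin; ∈-lookup)
open import Data.List.Relation.Unary.All as All using ()
open import Data.List.Relation.Unary.All.Properties using () renaming (tabulate⁻ to All-tabulate⁻)
open import Data.List.Relation.Unary.AllPairs using (_∷_)
open import Data.List.Relation.Unary.Any as Any using (Any; here; there; index)
open import Data.List.Relation.Unary.Any.Properties using (lookup-index; concatMap⁺)
  renaming (map⁺ to Any-map⁺; tabulate⁺ to Any-tabulate⁺)
open import Data.List.Relation.Unary.Enumerates.Setoid using (IsEnumeration)
open import Data.List.Relation.Unary.Enumerates.Setoid.Properties using (deduplicate⁺)
open import Data.List.Relation.Unary.Unique.DecSetoid.Properties using (deduplicate-!)
open import Data.List.Relation.Unary.Unique.Setoid using (Unique)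
open import Data.Nat.Base using (ℕ; zero; suc; _+_; _≤_; _<_; z≤n; s≤s; s≤s⁻¹; s<s⁻¹)
open import Data.Nat.Properties using (≤-refl; ≤-<-trans; <⇒≱; m<m+n; m<n+m)
open import Data.Product.Base using (∃; ∃-syntax; Σ-syntax; _×_; _,_; proj₁; proj₂)
open import Data.Product.Relation.Binary.Pointwise.Dependent as Pointwise using ()
open import Data.Sum.Base using (inj₁; inj₂)
open import Function.Base using (_∘′_)
open import Function.Bundles using (_⇔_; mk⇔; Inverse)
open import Level using (Level; _⊔_; Lift; lift; lower)
open import Relation.Binary.Bundles using (Setoid; DecSetoid)
open import Relation.Binary.Core using (REL)
open import Relation.Binary.Definitions using (Decidable; tri<; tri≈; tri>)
open import Relation.Binary.Indexed.Heterogeneous.Construct.At using (_atₛ_)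
open import Relation.Binary.PropositionalEquality using (_≡_; refl; sym; trans; cong; subst)
open import Relation.Binary.Structures using (IsEquivalence)
open import Relation.Nullary.Decidable.Core using (yes; no; map′; decidable-stable)
open import Relation.Nullary.Negation.Core using (¬_; contradiction)

private
  variable
    a b r ρ : Level

lower-em : ∀ b → ExcludedMiddle (a ⊔ b) → ExcludedMiddle a
lower-em b em {P} = map′ lower lift (em {Lift b P})

-- Finite setoids: numberings, enumerations and covering lists.

module _ (S : Setoid a r) where
  open Setoid S using (_≈_) renaming (Carrier to X; refl to ≈-refl; sym to ≈-sym; trans to ≈-trans)

  lookup-injective : ∀ {xs} → Unique S xs → ∀ i j → lookup xs i ≈ lookup xs j → i ≡ j
  lookup-injective (_  ∷ _) zero    zero    _  = refl
  lookup-injective (x∉ ∷ _) zero    (suc j) eq = contradiction eq (All.lookup x∉ (∈-lookup j))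
  lookup-injective (x∉ ∷ _) (suc i) zero    eq = contradiction (≈-sym eq) (All.lookup x∉ (∈-lookup i))
  lookup-injective (_  ∷ u) (suc i) (suc j) eq = cong suc (lookup-injective u i j eq)

  -- Once duplicates are removed, `lookup` is injective, so the position of an element in the list
  -- serves as its number.
  enumeration⇒finite : Decidable _≈_ → ∃ (IsEnumeration S) → Finite S
  enumeration⇒finite _≟_ (ys , ∈ys) = _ , record
    { to        = λ x → index (∈xs x)
    ; from      = lookup xs
    ; to-cong   = λ {x} {y} x≈y → lookup-injective unique _ _
        (≈-trans (≈-sym (lookup-index (∈xs x))) (≈-trans x≈y (lookup-index (∈xs y))))
    ; from-cong = λ where refl → ≈-refl
    ; inverse   =
        (λ {i} {x} x≈ → lookup-injective unique _ _ (≈-trans (≈-sym (lookup-index (∈xs x))) x≈))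
      , (λ {x} i≡ → subst (λ i → lookup xs i ≈ x) (sym i≡) (≈-sym (lookup-index (∈xs x))))
    }
    where
    S? : DecSetoid a r
    S? = record { isDecEquivalence = record { isEquivalence = Setoid.isEquivalence S ; _≟_ = _≟_ } }
    -- Solved by unification with the type of `deduplicate⁺ S? ∈ys`: it is `ys` without duplicates.
    xs = _
    ∈xs : IsEnumeration S xs
    ∈xs = deduplicate⁺ S? ∈ys
    unique : Unique S xs
    unique = deduplicate-! S? ys

  -- The list may have entries unrelated to S, which are discarded.
  module _ {Y : Set b} (_R_ : REL X Y ρ)
           (R-injective : ∀ {x x′ y} → x R y → x′ R y → x ≈ x′) where

    -- Excluded middle picks a witness for each entry that has one; by `R-injective`, any other
    -- element related to that entry equals the witness.
    enumerate : ExcludedMiddle (a ⊔ ρ) → ∀ ys → ∃[ xs ] (∀ {x} → Any (x R_) ys → Any (x ≈_) xs)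
    enumerate em [] = [] , λ ()
    enumerate em (y ∷ ys) with enumerate em ys | em {∃[ x ] x R y}
    ... | xs , f | yes (x , xRy) = x ∷ xs , λ where
      (here x′Ry) → here (R-injective x′Ry xRy)
      (there p)   → there (f p)
    ... | xs , f | no ¬∃ = xs , λ where
      (here x′Ry) → contradiction (_ , x′Ry) ¬∃
      (there p)   → f p

    cover⇒finite : ExcludedMiddle (a ⊔ ρ) → ExcludedMiddle r →
                   ∀ ys → (∀ x → Any (x R_) ys) → Finite S
    cover⇒finite em em′ ys covers =
      enumeration⇒finite (λ _ _ → em′)
        (proj₁ (enumerate em ys) , λ x → proj₂ (enumerate em ys) (covers x))

  numbering-injective : ((_ , inv) : Finite S) → ∀ x y →
                        Inverse.to inv x ≡ Inverse.to inv y → x ≈ y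
  numbering-injective (_ , inv) x y eq = ≈-trans (≈-sym (strictlyInverseʳ x)) (inverseʳ eq)
    where open Inverse inv

  finite⇒bounded : Finite S → (h : X → ℕ) → (∀ {x y} → x ≈ y → h x ≡ h y) →
                   ∃[ N ] (∀ x → h x ≤ N)
  finite⇒bounded (n , inv) h h-cong = N , λ x →
    subst (_≤ N) (h-cong (Inverse.strictlyInverseʳ inv x))
      (All-tabulate⁻ (xs≤max 0 (tabulate (h ∘′ from))) (to x))
    where
    open Inverse inv
    N = max 0 (tabulate (h ∘′ from))

  finite⇒enumeration : Finite S → ∃ (IsEnumeration S)
  finite⇒enumeration (n , inv) =
    tabulate from , λ x → Any-tabulate⁺ (to x) (≈-sym (strictlyInverseʳ x))
    where open Inverse inv

-- Concatenation of chains.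

module _ {o ℓ e} (C : Category o ℓ e) where
  open Category C
  open Decompositions C
  private module Eq {A B} = IsEquivalence (≈-equiv {A} {B})

  ≋-length : ∀ {m n A B} {c : Chain B m A} {d : Chain B n A} → c ≋ d → m ≡ n
  ≋-length [ _ ]    = refl
  ≋-length (_ ∷ ps) = cong suc (≋-length ps)

  infixr 5 _++_
  _++_ : ∀ {m n A M B} → Chain M m A → Chain B n M → Chain B (m + n) A
  [ f ]    ++ d = f ∷ d
  (f ∷ fs) ++ d = f ∷ (fs ++ d)

  compose-++ : ∀ {m n A M B} (c : Chain M m A) (d : Chain B n M) →
               compose (c ++ d) ≈ compose d ∘ compose c
  compose-++ [ f ]    d = Eq.refl
  compose-++ (f ∷ fs) d = Eq.trans (∘-cong (compose-++ fs d) Eq.refl) (assoc _ _ _)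

  NoIdentity-++ : ∀ {m n A M B} (c : Chain M m A) (d : Chain B n M) →
                  NoIdentity c → NoIdentity d → NoIdentity (c ++ d)
  NoIdentity-++ [ f ]    d p        q = p , q
  NoIdentity-++ (f ∷ fs) d (p , ps) q = p , NoIdentity-++ fs d ps q

  NoIdentity⇒Proper : ∀ {n A B} (c : Chain B n A) → NoIdentity c → Proper c
  NoIdentity⇒Proper [ _ ]   _  = _
  NoIdentity⇒Proper (_ ∷ _) ps = ps

  Chain-nonempty : ∀ {n A B} → Chain B n A → 0 < n
  Chain-nonempty [ _ ]   = s≤s z≤n
  Chain-nonempty (_ ∷ _) = s≤s z≤n

  -- Necessity of the three conditions.

  module _ (möbius : Möbius) where

    -- Built on `NoIdentity` instead of `Proper`, so that a single identity is excluded as well and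
    -- concatenation preserves the property.
    Strict : ∀ {A B} → Hom A B → ℕ → Set (o ⊔ ℓ ⊔ e)
    Strict {A} {B} g n = Σ[ c ∈ Chain B n A ] (NoIdentity c × compose c ≈ g)

    -- Length respects equality of tuples, so it is bounded on the finite `PD-setoid g`, whereas
    -- iterating `step` from `start` passes every bound.
    no-unbounded : ∀ {A B} {g : Hom A B} → ∃ (Strict g) →
                   (∀ n → Strict g n → ∃[ m ] (n < m × Strict g m)) → ⊥
    no-unbounded {g = g} start step =
      let N , bounded = finite⇒bounded (PD-setoid g) (möbius g) proj₁ Pointwise.proj₁
          n , N<n , c , c-proper , c≈g = long (suc N)
      in <⇒≱ N<n (bounded (n , (c , c≈g) , NoIdentity⇒Proper c c-proper))
      where
      long : ∀ k → ∃[ n ] (k ≤ n × Strict g n)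
      long zero = let n , s = start in n , z≤n , s
      long (suc k) with long k
      ... | n , k≤n , s with step n s
      ...   | m , n<m , t = m , ≤-<-trans k≤n n<m , t

    no-loopʳ : ∀ {n A B} {g : Hom A B} (c : Chain A n A) → NoIdentity c → ¬ IsIdentity g →
               ¬ g ∘ compose c ≈ g
    no-loopʳ {n} {g = g} c c-proper g-proper gc≈g =
      -- The chain `[ g ]` is the start; each step prepends the loop `c`, which has positive length
      -- and leaves the composite equal to `g`.
      no-unbounded (1 , [ g ] , g-proper , Eq.refl) λ m (d , d-proper , d≈g) →
        n + m , m<n+m m (Chain-nonempty c) , c ++ d , NoIdentity-++ c d c-proper d-proper ,
        Eq.trans (compose-++ c d) (Eq.trans (∘-cong d≈g Eq.refl) gc≈g)

    no-loopˡ : ∀ {n A B} {g : Hom A B} (c : Chain B n B) → NoIdentity c → ¬ IsIdentity g →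
               ¬ compose c ∘ g ≈ g
    no-loopˡ {n} {g = g} c c-proper g-proper cg≈g =
      no-unbounded (1 , [ g ] , g-proper , Eq.refl) λ m (d , d-proper , d≈g) →
        m + n , m<m+n m (Chain-nonempty c) , d ++ c , NoIdentity-++ d c d-proper c-proper ,
        Eq.trans (compose-++ d c) (Eq.trans (∘-cong Eq.refl d≈g) cg≈g)

    identity-indecomposable : ∀ {A} n → 2 ≤ n → ¬ PD n (id {A})
    identity-indecomposable _ (s≤s ()) (([ _ ] , _) , _)
    identity-indecomposable _ _ ((f ∷ fs , eq) , f-proper , fs-proper) =
      no-loopʳ (f ∷ fs) (f-proper , fs-proper) f-proper
        (Eq.trans (∘-cong Eq.refl eq) (identityʳ f))

    fixing⇒identity : ExcludedMiddle (ℓ ⊔ e) → ∀ {B} (f : Hom B B) → FixesSome f → IsIdentity f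
    fixing⇒identity em f (inj₁ (A , g , fg≈g)) = decidable-stable em λ ¬f →
      -- The fixed `g` is not an identity either: `g ≈ id` would turn `f ∘ g ≈ g` into `f ≈ id`.
      no-loopˡ [ f ] ¬f (λ { (is-id g≈id) → ¬f (is-id
        (Eq.trans (Eq.sym (identityʳ f)) (Eq.trans (∘-cong Eq.refl (Eq.sym g≈id))
          (Eq.trans fg≈g g≈id)))) }) fg≈g
    fixing⇒identity em f (inj₂ (D , g , gf≈g)) = decidable-stable em λ ¬f →
      no-loopʳ [ f ] ¬f (λ { (is-id g≈id) → ¬f (is-id
        (Eq.trans (Eq.sym (identityˡ f)) (Eq.trans (∘-cong (Eq.sym g≈id) Eq.refl)
          (Eq.trans gf≈g g≈id)))) }) gf≈g

    -- The numbers assigned to `PD-setoid f` form the covering list; those belonging to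
    -- decompositions of another length are discarded.
    PD-finite : ExcludedMiddle (o ⊔ ℓ ⊔ e) → ∀ n {A B} (f : Hom A B) →
                Finite (PD-indexedSetoid f atₛ n)
    PD-finite em n f = cover⇒finite (PD-indexedSetoid f atₛ n)
      (λ x i → to (n , x) ≡ i)
      (λ {x} {x′} p q → Pointwise.proj₂
        (numbering-injective (PD-setoid f) (möbius f) (n , x) (n , x′) (trans p (sym q))))
      em em (allFin _) (λ x → ∈-allFin (to (n , x)))
      where open Inverse (proj₂ (möbius f))

  -- Sufficiency of the three conditions.

  module _ (PD₂-finite : ∀ {A B} (f : Hom A B) → Finite (PD-indexedSetoid f atₛ 2))
           (id-indecomposable : ∀ {A} → ¬ PD 2 (id {A}))
           (fixing⇒identity : ∀ {B} (f : Hom B B) → FixesSome f → IsIdentity f) where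

    -- Otherwise `f` followed by `g` would be a proper decomposition of an identity.
    ∘-nonidentity : ∀ {A M B} {g : Hom M B} {f : Hom A M} →
                    ¬ IsIdentity f → ¬ IsIdentity g → ¬ IsIdentity (g ∘ f)
    ∘-nonidentity ¬f ¬g (is-id gf≈id) = id-indecomposable ((_ ∷ [ _ ] , gf≈id) , ¬f , ¬g)

    compose-nonidentity : ∀ {n A B} (c : Chain B n A) → NoIdentity c → ¬ IsIdentity (compose c)
    compose-nonidentity [ _ ]    p        = p
    compose-nonidentity (_ ∷ fs) (p , ps) = ∘-nonidentity p (compose-nonidentity fs ps)

    -- The cut at joint i, counted from 0, has the first i + 1 entries before it.
    joint : ∀ {n A B} → Chain B (suc n) A → Fin n → Obj
    joint (_∷_ {M = M} _ _)        zero    = M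
    joint {suc _} (_ ∷ fs) (suc i) = joint fs i

    before : ∀ {n A B} (c : Chain B (suc n) A) i → Hom A (joint c i)
    before (f ∷ _)          zero    = f
    before {suc _} (f ∷ fs) (suc i) = before fs i ∘ f

    after : ∀ {n A B} (c : Chain B (suc n) A) i → Hom (joint c i) B
    after (_ ∷ fs)         zero    = compose fs
    after {suc _} (_ ∷ fs) (suc i) = after fs i

    before-nonidentity : ∀ {n A B} (c : Chain B (suc n) A) i → NoIdentity c →
                         ¬ IsIdentity (before c i)
    before-nonidentity (_ ∷ _)          zero    (p , _)  = p
    before-nonidentity {suc _} (_ ∷ fs) (suc i) (p , ps) =
      ∘-nonidentity p (before-nonidentity fs i ps)

    after-nonidentity : ∀ {n A B} (c : Chain B (suc n) A) i → NoIdentity c →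
                        ¬ IsIdentity (after c i)
    after-nonidentity (_ ∷ fs)         zero    (_ , ps) = compose-nonidentity fs ps
    after-nonidentity {suc _} (_ ∷ fs) (suc i) (_ , ps) = after-nonidentity fs i ps

    after∘before : ∀ {n A B} (c : Chain B (suc n) A) i → after c i ∘ before c i ≈ compose c
    after∘before (_ ∷ _)          zero    = Eq.refl
    after∘before {suc _} (_ ∷ fs) (suc i) =
      Eq.trans (Eq.sym (assoc _ _ _)) (∘-cong (after∘before fs i) Eq.refl)

    -- The witness `h` composes the entries from joint `i` to joint `j`; there is at least one, and
    -- none is an identity.
    between : ∀ {n A B} (c : Chain B (suc n) A) {i j} → NoIdentity c → i <ᶠ j →
              Σ[ h ∈ Hom (joint c i) (joint c j) ] (¬ IsIdentity h × h ∘ before c i ≈ before c j)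
    between {suc _} (_ ∷ fs) {zero}  {suc j} (_ , ps) _ =
      before fs j , before-nonidentity fs j ps , Eq.refl
    between {suc _} (_ ∷ fs) {suc i} {suc j} (_ , ps) i<j
      with between fs ps (s<s⁻¹ i<j)
    ... | h , ¬h , eq = h , ¬h , Eq.trans (Eq.sym (assoc _ _ _)) (∘-cong eq Eq.refl)

    -- Equality of the two tuples identifies `M` with `M′`, so `h` becomes an endomorphism with
    -- `h ∘ p ≈ p`, and the condition on fixing morphisms makes it an identity.
    advancing-distinct : ∀ {A M M′ B} {p : Hom A M} {p′ : Hom A M′} {q : Hom M B} {q′ : Hom M′ B} →
                         Σ[ h ∈ Hom M M′ ] (¬ IsIdentity h × h ∘ p ≈ p′) →
                         ¬ (p ∷ [ q ] ≋ p′ ∷ [ q′ ])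
    advancing-distinct (h , ¬h , hp≈p′) (p≈p′ ∷ _) =
      ¬h (fixing⇒identity h (inj₁ (_ , _ , Eq.trans hp≈p′ (Eq.sym p≈p′))))

    length-bound : ∀ {n A B} {f : Hom A B} (c : Chain B (suc n) A) → NoIdentity c →
                   compose c ≈ f → n ≤ proj₁ (PD₂-finite f)
    length-bound {n} {f = f} c c-proper c≈f = injective⇒≤ {f = λ i → to (cut i)} cut-injective
      where
      S = PD-indexedSetoid f atₛ 2
      open Inverse (proj₂ (PD₂-finite f))
      cut : Fin n → PD 2 f
      cut i = (before c i ∷ [ after c i ] , Eq.trans (after∘before c i) c≈f)
            , before-nonidentity c i c-proper , after-nonidentity c i c-proper
      same-cut : ∀ i j → to (cut i) ≡ to (cut j) → Setoid._≈_ S (cut i) (cut j)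
      same-cut i j = numbering-injective S (PD₂-finite f) (cut i) (cut j)
      cut-injective : ∀ {i j} → to (cut i) ≡ to (cut j) → i ≡ j
      cut-injective {i} {j} eq with <-cmp i j
      ... | tri< i<j _ _ = contradiction (same-cut i j eq)
                               (advancing-distinct (between c c-proper i<j))
      ... | tri≈ _ i≡j _ = i≡j
      ... | tri> _ _ j<i = contradiction (same-cut j i (sym eq))
                               (advancing-distinct (between c c-proper j<i))

    -- A chain has one entry more than it has joints, hence the `suc`. Length one is treated apart,
    -- because its only entry may be an identity.
    PD-bound : ∀ {n A B} (f : Hom A B) → PD n f → n ≤ suc (proj₁ (PD₂-finite f))
    PD-bound f (([ _ ] , _) , _)          = s≤s z≤n
    PD-bound f ((g ∷ gs , eq) , c-proper) = s≤s (length-bound (g ∷ gs) c-proper eq)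

    -- The entries need not be proper decompositions.
    chains : ∀ (N : ℕ) {A B} (f : Hom A B) → List (∃[ n ] Chain B n A)
    chains zero    f = []
    chains (suc N) f = (1 , [ f ]) ∷ concatMap
      -- A longer chain is a first entry `g` followed by a chain composing to `h`, where `g` and `h`
      -- form a 2-decomposition of `f`.
      (λ { ((g ∷ [ h ] , _) , _) → map (λ (n , c) → suc n , g ∷ c) (chains N h) })
      (proj₁ (finite⇒enumeration (PD-indexedSetoid f atₛ 2) (PD₂-finite f)))

    -- Induction on `N`. The pair of `g` and `compose gs` is proper, so it equals a listed pair. The
    -- recursion in `chains` follows the second entry of that listed pair, which is only `≈` to
    -- `compose gs`; hence `f` is kept separate from `compose c`.
    chains-complete : ∀ (N : ℕ) {n A B} {f : Hom A B} (c : Chain B n A) → n ≤ N → Proper c →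
                      compose c ≈ f → Any (λ d → c ≋ proj₂ d) (chains N f)
    chains-complete (suc N) [ _ ]    _   _        c≈f = here [ c≈f ]
    chains-complete (suc N) {f = f} (g ∷ gs) n≤N (p , ps) c≈f = there (concatMap⁺ _
      (Any.map
        (λ { {(_ ∷ [ _ ] , _) , _} (g≈g′ ∷ [ h≈h′ ]) → Any-map⁺
          (Any.map (g≈g′ ∷_) (chains-complete N gs (s≤s⁻¹ n≤N) (NoIdentity⇒Proper gs ps) h≈h′)) })
        (proj₂ (finite⇒enumeration (PD-indexedSetoid f atₛ 2) (PD₂-finite f))
          ((g ∷ [ compose gs ] , c≈f) , p , compose-nonidentity gs ps))))

    möbius : ExcludedMiddle (o ⊔ ℓ ⊔ e) → Möbius
    möbius em f = cover⇒finite (PD-setoid f)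
      (λ (_ , (c , _) , _) (_ , d) → c ≋ d)
      (λ p q → let eq = ≋-trans p (≋-sym q) in ≋-length eq Pointwise., eq)
      em em (chains N f)
      (λ (_ , x@((c , c≈f) , c-proper)) → chains-complete N c (PD-bound f x) c-proper c≈f)
      where N = suc (proj₁ (PD₂-finite f))

theorem7p1 : ∀ {o ℓ e} → ExcludedMiddle (o ⊔ ℓ ⊔ e) → (C : Category o ℓ e) →
    let open Category C
        open Decompositions C
    in Möbius ⇔
         ( (∀ {A B} (f : Hom A B) → Finite (PD-indexedSetoid f atₛ 2))
         × (∀ {A} (n : ℕ) → 2 ≤ n → ¬ PD n (id {A}))
         × (∀ {B} (f : Hom B B) → FixesSome f → IsIdentity f) )
theorem7p1 {o} em C = mk⇔ necessary sufficient
  where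
  open Category C
  open Decompositions C

  Conditions : Set _
  Conditions = (∀ {A B} (f : Hom A B) → Finite (PD-indexedSetoid f atₛ 2))
             × (∀ {A} (n : ℕ) → 2 ≤ n → ¬ PD n (id {A}))
             × (∀ {B} (f : Hom B B) → FixesSome f → IsIdentity f)

  necessary : Möbius → Conditions
  necessary M = PD-finite C M em 2
              , identity-indecomposable C M
              , fixing⇒identity C M (lower-em o em)

  sufficient : Conditions → Möbius
  sufficient (PD₂-finite , indecomposable , fixing) =
    möbius C PD₂-finite (indecomposable 2 ≤-refl) fixing em
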